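{- There is an algorithm (in the unit-cost RAM model, using arrays) which, given an integer $n\ge 1$, after an $O(n)$ time initialization generates all parking functions of size $n$, each exactly once, in $O(1)$ worst-case time per parking function, using $O(n)$ space in total.
   Context: Parking functions: there are $n$ cars numbered $1,\dots,n$ and $n$ parking lots numbered consecutively $1,\dots,n$ along a one-way alley. A map $p:\{1,\dots,n\}\to\{1,\dots,n\}$ gives car $i$ the lot $p(i)$. If car $i$ finds lot $p(i)$ occupied, it may go on to a free lot with a greater number. The map $p$ is a parking function if every car can be parked. Equivalently, the nondecreasing rearrangement $b_1\le\cdots\le b_n$ of $(p(1),\dots,p(n))$ satisfies $b_i\le i$ for all $i=1,\dots,n$. Generation in $O(1)$ time per object (loop-less generation): the current object $(p(1),\dots,p(n))$ is held in memory, "generating" an object means that memory holds it at a designated output moment (the time to print it is not counted), and passing from the current object to the next one takes a number of elementary operations bounded by an absolute constant. The cost model is the standard unit-cost RAM in which elementary operations on integers and array entries of size $O(n)$ take $O(1)$ time and each such integer occupies one memory cell. -}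

module Defs where

open import Data.Bool using (if_then_else_)
open import Data.Fin using (Fin; zero; toℕ) renaming (_<_ to _<ᶠ_)
open import Data.List using (List; []; _∷_; head; drop)
open import Data.Maybe using (Maybe; just)
open import Data.Nat using (ℕ; suc; _+_; _∸_; _≤_; _<ᵇ_; _≡ᵇ_)
open import Data.Product using (∃-syntax; _×_)
open import Data.Sum using (_⊎_)
open import Data.Unit using (⊤)
open import Data.Vec using (Vec; lookup; replicate; _[_]≔_)
open import Relation.Binary.PropositionalEquality using (_≡_; _≢_)

-- Cars and lots 1, …, n are the elements of Fin n; k stands for suc (toℕ k).
-- A map {1, …, n} → {1, …, n} is given by its table of values, so that equality
-- of maps is _≡_.
Map : ℕ → Set
Map n = Vec (Fin n) n

-- p is a parking function if every car can be parked.  The cars arrive in the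
-- order 1, …, n, and car i ends up in the lot  lot i.
record ParkingFunction {n : ℕ} (p : Map n) : Set where
  field
    lot   : Fin n → Fin n
    free  : ∀ {i j} → j <ᶠ i → lot i ≢ lot j
    -- A car drives past its preferred lot only if an earlier car is there; it
    -- may then take any free lot with a greater number, not only the next one.
    parks : ∀ i → lot i ≡ lookup p i
                ⊎ (∃[ j ] (j <ᶠ i × lot j ≡ lookup p i)) × lookup p i <ᶠ lot i

-- A unit-cost RAM with  suc r  registers (register zero holds the input) and
-- suc a  arrays (array zero is the designated place of the generated object).
-- r and a belong to the program, and so do not depend on the input.

infix 6 _≔_ _≔ʳ_ _≔_⊕_ _≔_⊖_ _≔_⟨_⟩ _⟨_⟩≔_

data Op (r a : ℕ) : Set where
  _≔_           : Fin (suc r) → ℕ → Op r a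
  _≔ʳ_          : Fin (suc r) → Fin (suc r) → Op r a
  _≔_⊕_ _≔_⊖_   : Fin (suc r) → Fin (suc r) → Fin (suc r) → Op r a
  _≔_⟨_⟩        : Fin (suc r) → Fin (suc a) → Fin (suc r) → Op r a
  _⟨_⟩≔_        : Fin (suc a) → Fin (suc r) → Fin (suc r) → Op r a
  goto          : ℕ → Op r a
  if_<_goto_ if_≡_goto_ : Fin (suc r) → Fin (suc r) → ℕ → Op r a

data Instr (r a : ℕ) : Set where
  op          : Op r a → Instr r a
  output halt : Instr r a

record Program : Set where
  field
    r a  : ℕ
    code : List (Instr r a)

record Config (r a : ℕ) : Set where
  constructor ⟪_,_,_⟫
  field
    pc     : ℕ
    regs   : Vec ℕ (suc r)
    arrays : Vec (ℕ → ℕ) (suc a)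

write : (ℕ → ℕ) → ℕ → ℕ → (ℕ → ℕ)
write f i v j = if i ≡ᵇ j then v else f j

exec : ∀ {r a} → Op r a → Config r a → Config r a
exec (x ≔ k)            ⟪ pc , R , A ⟫ = ⟪ suc pc , R [ x ]≔ k , A ⟫
exec (x ≔ʳ y)           ⟪ pc , R , A ⟫ = ⟪ suc pc , R [ x ]≔ lookup R y , A ⟫
exec (x ≔ y ⊕ z)        ⟪ pc , R , A ⟫ =
  ⟪ suc pc , R [ x ]≔ (lookup R y + lookup R z) , A ⟫
exec (x ≔ y ⊖ z)        ⟪ pc , R , A ⟫ =
  ⟪ suc pc , R [ x ]≔ (lookup R y ∸ lookup R z) , A ⟫
exec (x ≔ b ⟨ y ⟩)      ⟪ pc , R , A ⟫ =
  ⟪ suc pc , R [ x ]≔ lookup A b (lookup R y) , A ⟫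
exec (b ⟨ y ⟩≔ x)       ⟪ pc , R , A ⟫ =
  ⟪ suc pc , R , A [ b ]≔ write (lookup A b) (lookup R y) (lookup R x) ⟫
exec (goto l)           ⟪ pc , R , A ⟫ = ⟪ l , R , A ⟫
exec (if x < y goto l)  ⟪ pc , R , A ⟫ =
  ⟪ (if lookup R x <ᵇ lookup R y then l else suc pc) , R , A ⟫
exec (if x ≡ y goto l)  ⟪ pc , R , A ⟫ =
  ⟪ (if lookup R x ≡ᵇ lookup R y then l else suc pc) , R , A ⟫

-- On a machine of size B every array consists of the cells 0, …, B only, and
-- every cell and register holds an integer ≤ B; thus the total space is
-- suc r + suc a * suc B.  The operations not listed create no new value and
-- access no array (⊖, being truncated, cannot exceed its first argument).
Legal : ∀ {r a} (B : ℕ) → Op r a → Config r a → Set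
Legal B (x ≔ k)       c = k ≤ B
Legal B (x ≔ y ⊕ z)   c = lookup (Config.regs c) y + lookup (Config.regs c) z ≤ B
Legal B (x ≔ b ⟨ y ⟩) c = lookup (Config.regs c) y ≤ B
Legal B (b ⟨ y ⟩≔ x)  c = lookup (Config.regs c) y ≤ B
Legal B _             c = ⊤

module _ (P : Program) where
  open Program P

  start : ℕ → Config r a
  start n = ⟪ 0 , replicate (suc r) 0 [ zero ]≔ n , replicate (suc a) (λ _ → 0) ⟫

  fetch : Config r a → Maybe (Instr r a)
  fetch c = head (drop (Config.pc c) code)

  resume : Config r a → Config r a
  resume ⟪ pc , R , A ⟫ = ⟪ suc pc , R , A ⟫

  -- Array zero holds p(1), …, p(n), in the cells 1, …, n.
  Holds : ∀ {n} → Config r a → Map n → Set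
  Holds c p = ∀ i → lookup (Config.arrays c) zero (suc (toℕ i)) ≡ suc (toℕ (lookup p i))

  -- c reaches c′ by t elementary operations, none of them an output.
  data Steps (B : ℕ) : Config r a → ℕ → Config r a → Set where
    done : ∀ {c} → Steps B c 0 c
    step : ∀ {c c′ o t} → fetch c ≡ just (op o) → Legal B o c →
           Steps B (exec o c) t c′ → Steps B c (suc t) c′

  -- From c, the machine of size B outputs exactly the given maps, in this
  -- order, and halts; the first output (or halting, if there is none) comes
  -- after at most s operations, and each later output, as well as the final
  -- halting, at most d operations after the previous output.
  data Generates (B d : ℕ) {n : ℕ} : ℕ → Config r a → List (Map n) → Set where
    halts   : ∀ {s t c c′} → Steps B c t c′ → t ≤ s → fetch c′ ≡ just halt →
              Generates B d s c []
    outputs : ∀ {s t c c′ p ps} → Steps B c t c′ → t ≤ s → fetch c′ ≡ just output →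
              Holds c′ p → Generates B d d (resume c′) ps →
              Generates B d s c (p ∷ ps)

{-# OPTIONS --safe #-}

-- A map is a parking function iff for every v at most n − v + 1 cars prefer a lot
-- ≥ v.  Hence all parking functions arise from (1, …, 1) by giving cars values
-- ≥ 2 in decreasing order of the values, where the value v may be given as long
-- as at least v cars still have the value 1.  This makes the parking functions
-- the nodes of a tree: a child of p has one more car with a value ≥ 2.  The cars
-- with value 1 form a linked list, a cursor in which (together with the current
-- value) determines the next child, so that moving to the first child, the next
-- sibling or the parent takes O(1) time.  Nodes at odd depth are output after
-- their descendants and the others before them; then there are O(1) moves
-- between any two consecutive outputs.

module Submission where

open import Defs
open import Data.Bool using (Bool; true; false; if_then_else_)
open import Data.Fin using (Fin; zero; suc; toℕ; fromℕ<) renaming (_<_ to _<ᶠ_; #_ to fin)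
open import Data.Fin.Properties using (toℕ-injective; toℕ-fromℕ<; toℕ<n)
  renaming (_≟_ to _≟ᶠ_; suc-injective to sucᶠ-injective)
open import Data.List using (List; []; _∷_; _++_; _ʳ++_; length; tabulate; allFin)
open import Data.List.Properties using (++-assoc; ++-identityʳ; length-tabulate)
open import Data.List.Membership.Propositional using (_∈_; _∉_)
open import Data.List.Membership.Propositional.Properties using (∈-++⁺ˡ; ∈-++⁺ʳ; ∈-++⁻; ∈-allFin)
open import Data.List.Relation.Binary.Permutation.Propositional
  using (_↭_; ↭-sym; ↭-trans; ↭-reflexive; prep; ↭⇒↭ₛ)
open import Data.List.Relation.Binary.Permutation.Propositional.Properties
  using (++↭ʳ++; shift; ∈-resp-↭; ↭-length)
import Data.List.Relation.Binary.Permutation.Setoid.Properties as Permutationₛ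
import Data.List.Relation.Unary.All as All
open import Data.List.Relation.Unary.AllPairs using ([]; _∷_)
open import Data.List.Relation.Unary.Any using (here; there)
open import Data.List.Relation.Unary.Unique.Propositional using (Unique)
open import Data.List.Relation.Unary.Unique.Propositional.Properties
  using (Unique[x∷xs]⇒x∉xs; allFin⁺) renaming (++⁺ to Unique-++⁺)
open import Data.Maybe using (just)
open import Data.Nat
  using (ℕ; zero; suc; _+_; _*_; _∸_; _≤_; _<_; z≤n; s≤s; s≤s⁻¹; _≤?_; _<?_; _≟_)
open import Data.Nat.Properties
  hiding (_≤?_; _<?_; _≟_)
open import Data.Product using (Σ-syntax; ∃-syntax; _×_; _,_; proj₁; proj₂)
open import Data.Sum using (_⊎_; inj₁; inj₂; [_,_]′)
open import Data.Unit using (⊤; tt)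
open import Data.Vec using (Vec; []; _∷_; lookup; replicate; _[_]≔_)
open import Data.Vec.Properties
  using (lookup∘update; lookup∘update′; lookup-replicate; ≡-dec; tabulate∘lookup; tabulate-cong)
open import Function using (_∘_; id)
open import Function.Bundles using (_⇔_; mk⇔)
open import Level using (0ℓ)
open import Relation.Binary.PropositionalEquality
open import Relation.Nullary using (¬_; Dec; yes; no; contradiction)
open import Relation.Nullary.Decidable using (_×-dec_; ¬?; dec-true; dec-false)
open import Relation.Unary using (Pred; Decidable)

private variable
  m n : ℕ

-- Counting

# : {P : Pred (Fin n) 0ℓ} → Decidable P → ℕ
# {zero}  P? = 0
# {suc n} P? with P? zero
... | yes _ = suc (# (P? ∘ suc))
... | no  _ = # (P? ∘ suc)

#suc≤# : {P : Pred (Fin (suc n)) 0ℓ} (P? : Decidable P) → # (P? ∘ suc) ≤ # P?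
#suc≤# P? with P? zero
... | yes _ = n≤1+n _
... | no _  = ≤-refl

#≤1+#suc : {P : Pred (Fin (suc n)) 0ℓ} (P? : Decidable P) → # P? ≤ suc (# (P? ∘ suc))
#≤1+#suc P? with P? zero
... | yes _ = ≤-refl
... | no _  = n≤1+n _

#suc<# : {P : Pred (Fin (suc n)) 0ℓ} (P? : Decidable P) → P zero → # (P? ∘ suc) < # P?
#suc<# P? p with P? zero
... | yes _ = ≤-refl
... | no ¬p = contradiction p ¬p

#-mono : {P Q : Pred (Fin n) 0ℓ} (P? : Decidable P) (Q? : Decidable Q) → (∀ i → P i → Q i) → # P? ≤ # Q?

#-strict : {P Q : Pred (Fin n) 0ℓ} (P? : Decidable P) (Q? : Decidable Q) → (∀ i → P i → Q i) →
           ∀ i → ¬ P i → Q i → # P? < # Q?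

#-insert : {P Q : Pred (Fin n) 0ℓ} (P? : Decidable P) (Q? : Decidable Q) →
           ∀ i → (∀ j → Q j → j ≡ i ⊎ P j) → # Q? ≤ suc (# P?)

#-mono {zero}  P? Q? f = z≤n
#-mono {suc n} P? Q? f with P? zero | Q? zero
... | yes p | yes q = s≤s (#-mono (P? ∘ suc) (Q? ∘ suc) (f ∘ suc))
... | yes p | no ¬q = contradiction (f zero p) ¬q
... | no ¬p | yes q = m≤n⇒m≤1+n (#-mono (P? ∘ suc) (Q? ∘ suc) (f ∘ suc))
... | no ¬p | no ¬q = #-mono (P? ∘ suc) (Q? ∘ suc) (f ∘ suc)

#-strict {suc n} P? Q? f zero ¬p q with P? zero | Q? zero
... | yes p | _     = contradiction p ¬p
... | no _  | yes _ = s≤s (#-mono (P? ∘ suc) (Q? ∘ suc) (f ∘ suc))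
... | no _  | no ¬q = contradiction q ¬q
#-strict {suc n} P? Q? f (suc i) ¬p q with P? zero | Q? zero
... | yes p  | yes _ = s≤s (#-strict (P? ∘ suc) (Q? ∘ suc) (f ∘ suc) i ¬p q)
... | yes p  | no ¬q = contradiction (f zero p) ¬q
... | no _   | yes _ = m≤n⇒m≤1+n (#-strict (P? ∘ suc) (Q? ∘ suc) (f ∘ suc) i ¬p q)
... | no _   | no _  = #-strict (P? ∘ suc) (Q? ∘ suc) (f ∘ suc) i ¬p q

#-insert {suc n} P? Q? zero f = ≤-trans (#≤1+#suc Q?)
  (s≤s (≤-trans (#-mono (Q? ∘ suc) (P? ∘ suc) tail) (#suc≤# P?)))
  where
  tail : ∀ j → _ → _
  tail j q with inj₂ p ← f (suc j) q = p
#-insert {suc n} {P} {Q} P? Q? (suc i) f with P? zero | Q? zero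
... | yes _ | yes _ = s≤s (#-insert (P? ∘ suc) (Q? ∘ suc) i f′)
  where f′ = λ j q → [ inj₁ ∘ sucᶠ-injective , inj₂ ]′ (f (suc j) q)
... | yes _ | no _  = m≤n⇒m≤1+n (#-insert (P? ∘ suc) (Q? ∘ suc) i f′)
  where f′ = λ j q → [ inj₁ ∘ sucᶠ-injective , inj₂ ]′ (f (suc j) q)
... | no _  | no _  = #-insert (P? ∘ suc) (Q? ∘ suc) i f′
  where f′ = λ j q → [ inj₁ ∘ sucᶠ-injective , inj₂ ]′ (f (suc j) q)
... | no ¬p | yes q with f zero q
...   | inj₂ p = contradiction p ¬p

#≤n : {P : Pred (Fin n) 0ℓ} (P? : Decidable P) → # P? ≤ n
#≤n {zero}  P? = z≤n
#≤n {suc n} P? with P? zero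
... | yes _ = s≤s (#≤n (P? ∘ suc))
... | no  _ = m≤n⇒m≤1+n (#≤n (P? ∘ suc))

#-empty : {P : Pred (Fin n) 0ℓ} (P? : Decidable P) → (∀ i → ¬ P i) → # P? ≡ 0
#-empty {zero}  P? ∄ = refl
#-empty {suc n} P? ∄ with P? zero
... | yes p = contradiction p (∄ zero)
... | no  _ = #-empty (P? ∘ suc) (∄ ∘ suc)

#-cong : {P Q : Pred (Fin n) 0ℓ} (P? : Decidable P) (Q? : Decidable Q) →
         (∀ i → P i → Q i) → (∀ i → Q i → P i) → # P? ≡ # Q?
#-cong P? Q? f g = ≤-antisym (#-mono P? Q? f) (#-mono Q? P? g)

#-toℕ≥ : ∀ u → # {n} (λ i → u ≤? toℕ i) ≡ n ∸ u
#-toℕ≥ {zero}  zero    = refl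
#-toℕ≥ {zero}  (suc u) = refl
#-toℕ≥ {suc n} zero    = cong suc (trans
  (#-cong {n} (λ i → 0 ≤? suc (toℕ i)) (λ i → 0 ≤? toℕ i) (λ _ _ → z≤n) (λ _ _ → z≤n)) (#-toℕ≥ {n} zero))
#-toℕ≥ {suc n} (suc u) = trans
  (#-cong {n} (λ i → suc u ≤? suc (toℕ i)) (λ i → u ≤? toℕ i) (λ _ → s≤s⁻¹) (λ _ → s≤s)) (#-toℕ≥ {n} u)

least : {P : Pred (Fin n) 0ℓ} (P? : Decidable P) → 0 < # P? →
        ∃[ i ] (P i × ∀ j → P j → toℕ i ≤ toℕ j)
least {suc n} P? h with P? zero
... | yes p = zero , p , λ _ _ → z≤n
... | no ¬p with least (P? ∘ suc) h
...   | i , p , min = suc i , p , λ { zero q → contradiction q ¬p ; (suc j) q → s≤s (min j q) }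

-- Pigeonhole by induction on `m`: when `f zero` satisfies `P`, this value is struck from `P`, and
-- injectivity keeps the later values among what is left. Injectivity is asked only for `j <ᶠ i`,
-- the form in which `ParkingFunction` gives it.
#-image : {P : Pred (Fin n) 0ℓ} (P? : Decidable P) (f : Fin m → Fin n) →
          (∀ {i j} → j <ᶠ i → f i ≢ f j) → # (P? ∘ f) ≤ # P?
#-image {m = zero}  P? f inj = z≤n
#-image {m = suc m} P? f inj with P? (f zero)
... | no _  = #-image P? (f ∘ suc) (λ j<i → inj (s≤s j<i))
... | yes p = ≤-trans (s≤s (≤-trans
    (#-mono _ (P′? ∘ f ∘ suc) λ i q → q , inj (s≤s z≤n))
    (#-image P′? (f ∘ suc) (λ j<i → inj (s≤s j<i)))))
    (#-strict P′? P? (λ _ → proj₁) (f zero) (λ q → proj₂ q refl) p)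
  where P′? = λ i → P? i ×-dec ¬? (i ≟ᶠ f zero)

-- Parking functions by counting

val : Map n → Fin n → ℕ
val p i = toℕ (lookup p i)

-- b_i ≤ i for all i says that for every u at most n − u cars prefer one of the
-- last n − u lots.
Bounded : Map n → Set
Bounded {n} p = ∀ u → # (λ i → u ≤? val p i) ≤ n ∸ u

-- No car ends below its preferred lot and the final lots are distinct, so the cars that prefer a
-- lot from `u` on inject into the lots from `u` on.
parking⇒bounded : (p : Map n) → ParkingFunction p → Bounded p
parking⇒bounded {n} p pf u = begin
  # (λ i → u ≤? val p i)        ≤⟨ #-mono (λ i → u ≤? val p i) (λ i → u ≤? toℕ (lot i))
                                     (λ i u≤ → ≤-trans u≤ (pref≤lot i)) ⟩
  # (λ i → u ≤? toℕ (lot i))    ≤⟨ #-image (λ l → u ≤? toℕ l) lot free ⟩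
  # {n} (λ l → u ≤? toℕ l)      ≡⟨ #-toℕ≥ {n} u ⟩
  n ∸ u                         ∎
  where
  open ParkingFunction pf
  open ≤-Reasoning
  pref≤lot : ∀ i → val p i ≤ toℕ (lot i)
  pref≤lot i with parks i
  ... | inj₁ eq       = ≤-reflexive (cong toℕ (sym eq))
  ... | inj₂ (_ , lt) = <⇒≤ lt

-- A form of `ParkingFunction` that allows induction over the cars: some lots may be occupied before
-- the first of the `m` cars arrives, and `¬ Free (f i)` is the case of a preferred lot occupied in
-- this way.
record Parked {Free : Pred (Fin n) 0ℓ} (Free? : Decidable Free) (f : Fin m → Fin n) : Set where
  field
    lot   : Fin m → Fin n
    free  : ∀ {i j} → j <ᶠ i → lot i ≢ lot j
    avail : ∀ i → Free (lot i)
    parks : ∀ i → lot i ≡ f i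
                ⊎ (¬ Free (f i) ⊎ ∃[ j ] (j <ᶠ i × lot j ≡ f i)) × f i <ᶠ lot i

-- Hall's condition for the cars still to come and the lots still free persists
-- when the next car takes the first free lot from its preferred one on.
park : {Free : Pred (Fin n) 0ℓ} (Free? : Decidable Free) (f : Fin m → Fin n) →
       (∀ u → # (λ i → u ≤? toℕ (f i)) ≤ # (λ l → Free? l ×-dec (u ≤? toℕ l))) →
       Parked Free? f
park {m = zero}  Free? f hall = record
  { lot = λ () ; free = λ { {()} } ; avail = λ () ; parks = λ () }
park {n = n} {m = suc m} {Free} Free? f hall = result
  where
  pref = f zero

  choice = least (λ l → Free? l ×-dec (toℕ pref ≤? toℕ l))
             (≤-trans (≤-trans (s≤s z≤n) (#suc<# (λ i → toℕ pref ≤? toℕ (f i)) ≤-refl)) (hall (toℕ pref)))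
  ℓ      = proj₁ choice
  ℓ-free = proj₁ (proj₁ (proj₂ choice))
  pref≤ℓ = proj₂ (proj₁ (proj₂ choice))
  ℓ-min  = proj₂ (proj₂ choice)

  Free′? = λ l → Free? l ×-dec ¬? (l ≟ᶠ ℓ)

  lots : ∀ u → u ≤ toℕ ℓ → # (λ l → Free′? l ×-dec (u ≤? toℕ l)) < # (λ l → Free? l ×-dec (u ≤? toℕ l))
  lots u u≤ℓ = #-strict _ _ (λ l q → proj₁ (proj₁ q) , proj₂ q) ℓ
    (λ q → proj₂ (proj₁ q) refl) (ℓ-free , u≤ℓ)

  lots′ : ∀ u → # (λ l → Free? l ×-dec (u ≤? toℕ l)) ≤ suc (# (λ l → Free′? l ×-dec (u ≤? toℕ l)))
  lots′ u = #-insert _ _ ℓ split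
    where
    split : ∀ l → Free l × u ≤ toℕ l → l ≡ ℓ ⊎ (Free l × l ≢ ℓ) × u ≤ toℕ l
    split l (fr , u≤) with l ≟ᶠ ℓ
    ... | yes eq = inj₁ eq
    ... | no neq = inj₂ ((fr , neq) , u≤)

  hall′ : ∀ u → # (λ i → u ≤? toℕ (f (suc i))) ≤ # (λ l → Free′? l ×-dec (u ≤? toℕ l))
  hall′ u with u ≤? toℕ pref | u ≤? toℕ ℓ
  ... | yes u≤p | _ = s≤s⁻¹ (begin
    suc (# (λ i → u ≤? toℕ (f (suc i))))               ≤⟨ #suc<# (λ i → u ≤? toℕ (f i)) u≤p ⟩
    # (λ i → u ≤? toℕ (f i))                           ≤⟨ hall u ⟩
    # (λ l → Free? l ×-dec (u ≤? toℕ l))               ≤⟨ lots′ u ⟩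
    suc (# (λ l → Free′? l ×-dec (u ≤? toℕ l)))        ∎)
    where open ≤-Reasoning
  -- No lot from `pref` up to `ℓ` is free, so the free lots from `pref` on all lie from `u` on;
  -- Hall's condition at `pref`, which also counts the current car, then has one lot to spare.
  ... | no u≰p | yes u≤ℓ = s≤s⁻¹ (begin
    suc (# (λ i → u ≤? toℕ (f (suc i))))               ≤⟨ s≤s (#-mono _ (λ i → toℕ pref ≤? toℕ (f (suc i)))
                                                        λ _ → ≤-trans (<⇒≤ (≰⇒> u≰p))) ⟩
    suc (# (λ i → toℕ pref ≤? toℕ (f (suc i))))        ≤⟨ #suc<# (λ i → toℕ pref ≤? toℕ (f i)) ≤-refl ⟩
    # (λ i → toℕ pref ≤? toℕ (f i))                    ≤⟨ hall _ ⟩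
    # (λ l → Free? l ×-dec (toℕ pref ≤? toℕ l))        ≤⟨ #-mono _ (λ l → Free? l ×-dec (u ≤? toℕ l))
                                                        (λ l q → proj₁ q , ≤-trans u≤ℓ (ℓ-min l q)) ⟩
    # (λ l → Free? l ×-dec (u ≤? toℕ l))               ≤⟨ lots′ u ⟩
    suc (# (λ l → Free′? l ×-dec (u ≤? toℕ l)))        ∎)
    where open ≤-Reasoning
  ... | no _ | no u≰ℓ = begin
    # (λ i → u ≤? toℕ (f (suc i)))                     ≤⟨ #suc≤# (λ i → u ≤? toℕ (f i)) ⟩
    # (λ i → u ≤? toℕ (f i))                           ≤⟨ hall u ⟩
    # (λ l → Free? l ×-dec (u ≤? toℕ l))               ≤⟨ #-mono _ (λ l → Free′? l ×-dec (u ≤? toℕ l))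
                                                        (λ { l (fr , u≤l) → (fr , λ { refl → u≰ℓ u≤l }) , u≤l }) ⟩
    # (λ l → Free′? l ×-dec (u ≤? toℕ l))              ∎
    where open ≤-Reasoning

  rest = park Free′? (f ∘ suc) hall′
  module R = Parked rest

  lot : Fin (suc m) → Fin n
  lot zero    = ℓ
  lot (suc i) = R.lot i

  parks : ∀ i → lot i ≡ f i ⊎ (¬ Free (f i) ⊎ ∃[ j ] (j <ᶠ i × lot j ≡ f i)) × f i <ᶠ lot i
  parks zero with ℓ ≟ᶠ pref
  ... | yes eq = inj₁ eq
  ... | no neq = inj₂ (inj₁ (λ fr → <⇒≱ pref<ℓ (ℓ-min pref (fr , ≤-refl))) , pref<ℓ)
    where pref<ℓ = ≤∧≢⇒< pref≤ℓ (λ eq → neq (sym (toℕ-injective eq)))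
  parks (suc i) with R.parks i
  ... | inj₁ eq = inj₁ eq
  ... | inj₂ (inj₂ (j , j<i , eq) , lt) = inj₂ (inj₂ (suc j , s≤s j<i , eq) , lt)
  -- A lot that is not free for the later cars was either occupied from the outset or has just been
  -- taken by car `zero`.
  ... | inj₂ (inj₁ taken , lt) with ℓ ≟ᶠ f (suc i)
  ...   | yes eq = inj₂ (inj₂ (zero , s≤s z≤n , eq) , lt)
  ...   | no neq = inj₂ (inj₁ (λ fr → taken (fr , neq ∘ sym)) , lt)

  distinct : ∀ {i j} → j <ᶠ i → lot i ≢ lot j
  distinct {suc i} {zero}  _         = proj₂ (R.avail i)
  distinct {suc i} {suc j} (s≤s j<i) = R.free j<i

  result : Parked Free? f
  result = record
    { lot   = lot
    ; free  = distinct
    ; avail = λ { zero → ℓ-free ; (suc i) → proj₁ (R.avail i) }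
    ; parks = parks
    }

bounded⇒parking : (p : Map n) → Bounded p → ParkingFunction p
bounded⇒parking {n} p bd = record { lot = lot ; free = free ; parks = parks′ }
  where
  Any? : Decidable {A = Fin n} (λ _ → ⊤)
  Any? _ = yes tt
  hall : ∀ u → # (λ i → u ≤? val p i) ≤ # (λ l → Any? l ×-dec (u ≤? toℕ l))
  hall u = ≤-trans (bd u) (≤-trans (≤-reflexive (sym (#-toℕ≥ {n} u)))
             (#-mono _ (λ l → Any? l ×-dec (u ≤? toℕ l)) λ _ → tt ,_))
  open Parked (park Any? (lookup p) hall)
  parks′ : ∀ i → lot i ≡ lookup p i ⊎ (∃[ j ] (j <ᶠ i × lot j ≡ lookup p i)) × lookup p i <ᶠ lot i
  parks′ i with parks i
  ... | inj₁ eq            = inj₁ eq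
  ... | inj₂ (inj₁ ¬⊤ , _) = contradiction tt ¬⊤
  ... | inj₂ (inj₂ x , lt) = inj₂ (x , lt)

-- The program

program : Program
program = record { r = 9 ; a = 3 ; code =
    op (one ≔ 1)
  ∷ op (if q ≡ rn goto 7)     -- 1
  ∷ op (l ≔ʳ q)
  ∷ op (q ≔ q ⊕ one)
  ∷ op (next ⟨ l ⟩≔ q)
  ∷ op (object ⟨ q ⟩≔ one)
  ∷ op (goto 1)
  ∷ op (w ≔ʳ rn)              -- 7
  ∷ op (s ≔ʳ rn)
  ∷ op (l ≔ʳ z)
  ∷ output
  ∷ op (if w ≡ one goto 29)   -- 11
  -- With fewer than `w` cars at 1, or at the end of the list, the next lower value is tried from
  -- the head of the list.
  ∷ op (if s < w goto 26)
  ∷ op (q ≔ next ⟨ l ⟩)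
  ∷ op (if q ≡ z goto 26)
  ∷ op (object ⟨ q ⟩≔ w)
  ∷ op (t ≔ next ⟨ q ⟩)
  -- `q` is bypassed but keeps its own `next`, so that it can be put back in O(1) time.
  ∷ op (next ⟨ l ⟩≔ t)
  ∷ op (pred ⟨ q ⟩≔ l)
  ∷ op (parent ⟨ q ⟩≔ top)
  ∷ op (top ≔ʳ q)
  ∷ op (s ≔ s ⊖ one)
  -- `b` is still the parity of the parent; if it is 1, the new node has even depth and is output at
  -- once.
  ∷ op (if b ≡ z goto 24)
  ∷ output
  ∷ op (b ≔ one ⊖ b)          -- 24
  ∷ op (goto 11)
  ∷ op (w ≔ w ⊖ one)          -- 26
  ∷ op (l ≔ʳ z)
  ∷ op (goto 11)
  ∷ op (if top ≡ z goto 42)   -- 29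
  ∷ op (b ≔ one ⊖ b)
  -- `b` is again the parity of the parent; if it is 0, the node being left has odd depth and is
  -- output before it is undone.
  ∷ op (if b ≡ one goto 33)
  ∷ output
  ∷ op (q ≔ʳ top)             -- 33
  -- The car itself records the value and the place at which the search of its siblings resumes.
  ∷ op (w ≔ object ⟨ q ⟩)
  ∷ op (object ⟨ q ⟩≔ one)
  ∷ op (l ≔ pred ⟨ q ⟩)
  ∷ op (next ⟨ l ⟩≔ q)
  ∷ op (top ≔ parent ⟨ q ⟩)
  ∷ op (s ≔ one ⊕ s)
  ∷ op (l ≔ʳ q)
  ∷ op (goto 11)
  ∷ halt                      -- 42
  ∷ [] }
  where
  -- w is the value being given, l the cell before the cursor, q the car at the
  -- cursor, top the last car with a value other than 1, s the number of cars in
  -- the free list, and b the parity of the depth in the search tree.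
  rn one w l q top s b z t : Fin 10
  rn  = fin 0
  one = fin 1
  w   = fin 2
  l   = fin 3
  q   = fin 4
  top = fin 5
  s   = fin 6
  b   = fin 7
  z   = fin 8
  t   = fin 9

  object next pred parent : Fin 4
  object = fin 0
  next   = fin 1
  pred   = fin 2
  parent = fin 3

private variable
  s w : ℕ
  q : Fin n
  p x : Map n
  F xs ys : List (Fin n)

-- Lists split at a cursor, the part before it reversed

ʳ++-shift : ∀ {A : Set} (xs : List A) {q ys} → xs ʳ++ (q ∷ ys) ↭ q ∷ (xs ʳ++ ys)
ʳ++-shift xs {q} {ys} = ↭-trans (↭-sym (++↭ʳ++ xs (q ∷ ys)))
  (↭-trans (shift q xs ys) (prep q (++↭ʳ++ xs ys)))

∈-ʳ++ˡ : ∀ {A : Set} {i : A} {xs} ys → i ∈ xs → i ∈ xs ʳ++ ys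
∈-ʳ++ˡ {xs = xs} ys i∈ = ∈-resp-↭ (++↭ʳ++ xs ys) (∈-++⁺ˡ i∈)

∈-ʳ++ʳ : ∀ {A : Set} {i : A} xs {ys} → i ∈ ys → i ∈ xs ʳ++ ys
∈-ʳ++ʳ xs {ys} i∈ = ∈-resp-↭ (++↭ʳ++ xs ys) (∈-++⁺ʳ xs i∈)

Unique-resp-↭ : ∀ {A : Set} {xs ys : List A} → xs ↭ ys → Unique xs → Unique ys
Unique-resp-↭ {A} = Permutationₛ.Unique-resp-↭ (setoid A) ∘ ↭⇒↭ₛ

-- The search tree

lookup-injective : ∀ {A : Set} {u v : Vec A n} → (∀ i → lookup u i ≡ lookup v i) → u ≡ v
lookup-injective eq = trans (sym (tabulate∘lookup _)) (trans (tabulate-cong eq) (tabulate∘lookup _))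

-- The s cars in F still have the value 1, and all others a value ≥ suc w.  (As in
-- val, w stands for the value suc w.)
record State {n : ℕ} (s w : ℕ) (F : List (Fin n)) (p : Map n) : Set where
  field
    ones    : ∀ {i} → i ∈ F → val p i ≡ 0
    large   : ∀ i → i ∈ F ⊎ w ≤ val p i
    unique  : Unique F
    size    : length F ≡ s
    count   : s + # (λ i → 1 ≤? val p i) ≡ n
    bounded : Bounded p

put : Map n → Fin n → w < n → Map n
put p q w<n = p [ q ]≔ fromℕ< w<n

val-put-≡ : (p : Map n) (q : Fin n) (w<n : w < n) → val (put p q w<n) q ≡ w
val-put-≡ p q w<n = trans (cong toℕ (lookup∘update q p _)) (toℕ-fromℕ< w<n)

lookup-put-≢ : (p : Map n) {q i : Fin n} (w<n : w < n) → i ≢ q → lookup (put p q w<n) i ≡ lookup p i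
lookup-put-≢ p w<n i≢q = lookup∘update′ i≢q p _

val-put-≢ : (p : Map n) {q i : Fin n} (w<n : w < n) → i ≢ q → val (put p q w<n) i ≡ val p i
val-put-≢ p w<n i≢q = cong toℕ (lookup-put-≢ p w<n i≢q)

lower : State s (suc w) F p → State s w F p
lower σ = record
  { ones = ones ; large = λ i → [ inj₁ , inj₂ ∘ ≤-trans (n≤1+n _) ]′ (large i)
  ; unique = unique ; size = size ; count = count ; bounded = bounded }
  where open State σ

take : ∀ {n s w q ys p} (xs : List (Fin n)) (w<n : suc w < n) → suc w ≤ s →
       State (suc s) (suc w) (xs ʳ++ (q ∷ ys)) p → State s (suc w) (xs ʳ++ ys) (put p q w<n)
take {n} {s} {w} {q} {ys} {p} xs w<n w≤s σ = record
  { ones    = λ i∈ → trans (val-put-≢ p w<n λ { refl → q∉ i∈ }) (ones (∈-resp-↭ (↭-sym perm) (there i∈)))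
  ; large   = large′
  ; unique  = tail unique′
  ; size    = suc-injective (trans (sym (↭-length perm)) size)
  ; count   = count′
  ; bounded = bounded′
  }
  where
  open State σ
  perm = ʳ++-shift xs {q} {ys}
  p′ = put p q w<n
  unique′ = Unique-resp-↭ perm unique
  q∉ = Unique[x∷xs]⇒x∉xs unique′
  tail : Unique (q ∷ F) → Unique F
  tail (_ ∷ u) = u
  vq = val-put-≡ p q w<n
  q≡0 : val p q ≡ 0
  q≡0 = ones (∈-ʳ++ʳ xs (here refl))

  large′ : ∀ i → i ∈ xs ʳ++ ys ⊎ suc w ≤ val p′ i
  large′ i with i ≟ᶠ q
  ... | yes refl = inj₂ (≤-reflexive (sym vq))
  ... | no i≢q with large i
  ...   | inj₂ w≤ = inj₂ (≤-trans w≤ (≤-reflexive (sym (val-put-≢ p w<n i≢q))))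
  ...   | inj₁ i∈ with ∈-resp-↭ perm i∈
  ...     | here eq   = contradiction eq i≢q
  ...     | there i∈′ = inj₁ i∈′

  split : ∀ u i → u ≤ val p′ i → i ≡ q ⊎ u ≤ val p i
  split u i u≤ with i ≟ᶠ q
  ... | yes eq = inj₁ eq
  ... | no i≢q = inj₂ (≤-trans u≤ (≤-reflexive (val-put-≢ p w<n i≢q)))

  grow : ∀ i → 1 ≤ val p i → 1 ≤ val p′ i
  grow i 1≤ with i ≟ᶠ q
  ... | yes refl = ≤-trans (s≤s z≤n) (≤-reflexive (sym vq))
  ... | no i≢q = ≤-trans 1≤ (≤-reflexive (sym (val-put-≢ p w<n i≢q)))

  #′≡ : # (λ i → 1 ≤? val p′ i) ≡ suc (# (λ i → 1 ≤? val p i))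
  #′≡ = ≤-antisym
    (#-insert (λ i → 1 ≤? val p i) (λ i → 1 ≤? val p′ i) q (split 1))
    (#-strict (λ i → 1 ≤? val p i) (λ i → 1 ≤? val p′ i) grow q
      (λ 1≤ → <⇒≱ 1≤ (≤-reflexive q≡0)) (≤-trans (s≤s z≤n) (≤-reflexive (sym vq))))

  count′ : s + # (λ i → 1 ≤? val p′ i) ≡ n
  count′ = trans (cong (s +_) #′≡) (trans (+-suc s _) count)

  -- Only thresholds u ≤ suc w see the new value, and those that are not 0 see
  -- at most all the cars outside the free list.
  bounded′ : Bounded p′
  bounded′ zero = #≤n (λ i → 0 ≤? val p′ i)
  bounded′ (suc u) with suc u ≤? suc w
  ... | yes u≤w = begin
    # (λ i → suc u ≤? val p′ i)  ≤⟨ #-mono (λ i → suc u ≤? val p′ i) (λ i → 1 ≤? val p′ i)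
                                            (λ _ → ≤-trans (s≤s z≤n)) ⟩
    # (λ i → 1 ≤? val p′ i)      ≡⟨ m+n∸m≡n s _ ⟨
    s + # (λ i → 1 ≤? val p′ i) ∸ s ≡⟨ cong (_∸ s) count′ ⟩
    n ∸ s                        ≤⟨ ∸-monoʳ-≤ n (≤-trans u≤w w≤s) ⟩
    n ∸ suc u                    ∎
    where open ≤-Reasoning
  ... | no u≰w = ≤-trans (#-mono (λ i → suc u ≤? val p′ i) (λ i → suc u ≤? val p i) old) (bounded (suc u))
    where
    old : ∀ i → suc u ≤ val p′ i → suc u ≤ val p i
    old i u≤ with split (suc u) i u≤
    ... | inj₂ u≤′ = u≤′
    ... | inj₁ refl = contradiction (≤-trans u≤ (≤-reflexive vq)) u≰w

mutual
  -- The search below a parking function p when the cursor splits its free list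
  -- into the cars xs already considered for the value suc w, in reverse, and
  -- the cars ys not yet considered.  In a Forest⁺ the cursor is at a car that
  -- may take the value, if there is any left.
  data Forest {n : ℕ} : (s w : ℕ) (xs ys : List (Fin n)) (p : Map n) → Set where
    stay : ∀ {s w xs ys p} → Forest⁺ s w xs ys p → Forest s w xs ys p
    row  : ∀ {s w xs ys p} → State s (suc w) (xs ʳ++ ys) p →
           s ≤ suc w ⊎ suc w < s × ys ≡ [] →
           Forest⁺ s w [] (xs ʳ++ ys) p → Forest s (suc w) xs ys p

  data Forest⁺ {n : ℕ} : (s w : ℕ) (xs ys : List (Fin n)) (p : Map n) → Set where
    stop : ∀ {s xs ys p} → State s 0 (xs ʳ++ ys) p → Forest⁺ s 0 xs ys p
    node : ∀ {s w xs q ys p} → State (suc s) (suc w) (xs ʳ++ (q ∷ ys)) p →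
           (w<n : suc w < n) → suc w ≤ s →
           Forest s (suc w) xs ys (put p q w<n) →
           Forest (suc s) (suc w) (q ∷ xs) ys p →
           Forest⁺ (suc s) (suc w) xs (q ∷ ys) p

mutual
  -- The recursion is lexicographic: taking or skipping a car shortens `ys` at the same `w`, and
  -- going back to the whole list lowers `w`.
  forest : ∀ {n s} w {xs} ys {p : Map n} → State s w (xs ʳ++ ys) p → w < n → w ≤ s → Forest s w xs ys p
  forest zero ys σ w<n w≤s = stay (stop σ)
  forest (suc w) ys σ w<n w≤s = search (suc w) ys σ (s≤s z≤n) w<n w≤s (_ ≤? suc w)

  search : ∀ {n s} w {xs} ys {p : Map n} → State s w (xs ʳ++ ys) p → 1 ≤ w → w < n → w ≤ s → Dec (s ≤ w) →
           Forest s w xs ys p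
  search (suc w) ys       σ _   w<n w≤s (yes s≤w) =
    row σ (inj₁ s≤w) (restart w _ (lower σ) (<⇒≤ w<n) w≤s)
  search (suc w) []       σ _   w<n w≤s (no s≰w)  =
    row σ (inj₂ (≰⇒> s≰w , refl)) (restart w _ (lower σ) (<⇒≤ w<n) w≤s)
  search (suc w) (q ∷ ys) σ 1≤w w<n w≤s (no s≰w)  =
    stay (branch (suc w) ys σ 1≤w w<n (≰⇒> s≰w))

  -- The bound `w ≤ s` becomes strict when the value goes down by one, and then the list is not
  -- empty. So either the values are exhausted or a car can take the new value at once; two changes
  -- of value never follow each other directly.
  restart : ∀ {n s} w ys {p : Map n} → State s w ys p → w < n → w < s → Forest⁺ s w [] ys p
  restart zero    ys       σ w<n w<s = stop σ
  restart (suc w) (q ∷ ys) σ w<n w<s = branch (suc w) ys σ (s≤s z≤n) w<n w<s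
  restart (suc w) []       σ w<n w<s = contradiction w<s (subst (λ s → ¬ suc w < s) (State.size σ) λ ())

  branch : ∀ {n s} w {xs q} ys {p : Map n} → State s w (xs ʳ++ (q ∷ ys)) p → 1 ≤ w → w < n → w < s →
           Forest⁺ s w xs (q ∷ ys) p
  branch {s = suc s} (suc w) {xs} ys σ _ w<n (s≤s w≤s) = node σ w<n w≤s
    (forest (suc w) ys (take xs w<n w≤s σ) w<n w≤s)
    (forest (suc w) ys σ w<n (m≤n⇒m≤1+n w≤s))

-- The listing of the tree and its exactness

mutual
  -- The flag is the parity of the depth of `p`. It flips on descent to a child and is kept among
  -- siblings.
  maps : ∀ {n s w xs ys} {p : Map n} → Bool → Forest s w xs ys p → List (Map n)
  maps b (stay t)    = maps⁺ b t
  maps b (row _ _ t) = maps⁺ b t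

  maps⁺ : ∀ {n s w xs ys} {p : Map n} → Bool → Forest⁺ s w xs ys p → List (Map n)
  maps⁺ b     (stop _) = []
  maps⁺ true  (node {q = q} {p = p} σ w<n _ t u) = put p q w<n ∷ maps false t ++ maps true u
  maps⁺ false (node {q = q} {p = p} σ w<n _ t u) = maps true t ++ put p q w<n ∷ maps false u

-- A description, independent of the tree, of the maps that the search below `p` has yet to list.
-- The cars of `xs` have been passed over for the value `w`, hence the strict bound for them.
record Extends {n : ℕ} (w : ℕ) (xs ys : List (Fin n)) (p x : Map n) : Set where
  field
    same    : ∀ i → i ∈ xs ʳ++ ys ⊎ lookup x i ≡ lookup p i
    ≤w      : ∀ {i} → i ∈ xs ʳ++ ys → val x i ≤ w
    <w      : ∀ {i} → i ∈ xs → val x i < w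
    other   : x ≢ p
    bounded : Bounded x

module _ {n s w q ys} {xs : List (Fin n)} {p : Map n}
         (σ : State (suc s) (suc w) (xs ʳ++ (q ∷ ys)) p) (w<n : suc w < n) (w≤s : suc w ≤ s) where

  private
    open State σ
    perm = ʳ++-shift xs {q} {ys}
    q∉ = Unique[x∷xs]⇒x∉xs (Unique-resp-↭ perm unique)
    p′ = put p q w<n
    vq = val-put-≡ p q w<n
    q∈ : q ∈ xs ʳ++ (q ∷ ys)
    q∈ = ∈-ʳ++ʳ xs (here refl)
    q≡0 = ones q∈

    widen : ∀ {i} → i ∈ xs ʳ++ ys → i ∈ xs ʳ++ (q ∷ ys)
    widen i∈ = ∈-resp-↭ (↭-sym perm) (there i∈)

    narrow : ∀ {i} → i ∈ xs ʳ++ (q ∷ ys) → i ≢ q → i ∈ xs ʳ++ ys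
    narrow i∈ i≢q with ∈-resp-↭ perm i∈
    ... | here eq = contradiction eq i≢q
    ... | there i∈′ = i∈′

    differs : ∀ {x} → val x q ≡ suc w → x ≢ p
    differs eq refl with () ← trans (sym eq) q≡0

  -- This and the next lemmas split the extensions by the value of `q`: it is `suc w` in the child
  -- itself and in the maps below the child, and smaller in the maps of the later siblings.
  put-extends : Extends (suc w) xs (q ∷ ys) p p′
  put-extends = record
    { same = same ; ≤w = ≤w ; <w = <w ; other = differs vq
    ; bounded = State.bounded (take xs w<n w≤s σ) }
    where
    same : ∀ i → i ∈ xs ʳ++ (q ∷ ys) ⊎ lookup p′ i ≡ lookup p i
    same i with i ≟ᶠ q
    ... | yes refl = inj₁ q∈
    ... | no i≢q   = inj₂ (lookup-put-≢ p w<n i≢q)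
    ≤w : ∀ {i} → i ∈ xs ʳ++ (q ∷ ys) → val p′ i ≤ suc w
    ≤w {i} i∈ with i ≟ᶠ q
    ... | yes refl = ≤-reflexive vq
    ... | no i≢q   = ≤-trans (≤-reflexive (trans (val-put-≢ p w<n i≢q) (ones i∈))) z≤n
    <w : ∀ {i} → i ∈ xs → val p′ i < suc w
    <w i∈ = s≤s (≤-trans (≤-reflexive (trans
      (val-put-≢ p w<n λ { refl → q∉ (∈-ʳ++ˡ ys i∈) }) (ones (∈-ʳ++ˡ (q ∷ ys) i∈)))) z≤n)

  module _ {x : Map n} where

    taken-value : Extends (suc w) xs ys p′ x → val x q ≡ suc w
    taken-value ε with Extends.same ε q
    ... | inj₁ q∈′ = contradiction q∈′ q∉
    ... | inj₂ eq  = trans (cong toℕ eq) vq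

    taken⇒extends : Extends (suc w) xs ys p′ x → Extends (suc w) xs (q ∷ ys) p x
    taken⇒extends ε = record
      { same = same′ ; ≤w = ≤w′ ; <w = <w ; other = differs (taken-value ε) ; bounded = bdd }
      where
      open Extends ε renaming (bounded to bdd)
      same′ : ∀ i → i ∈ xs ʳ++ (q ∷ ys) ⊎ lookup x i ≡ lookup p i
      same′ i with same i | i ≟ᶠ q
      ... | _        | yes refl = inj₁ q∈
      ... | inj₁ i∈  | no _     = inj₁ (widen i∈)
      ... | inj₂ eq  | no i≢q   = inj₂ (trans eq (lookup-put-≢ p w<n i≢q))
      ≤w′ : ∀ {i} → i ∈ xs ʳ++ (q ∷ ys) → val x i ≤ suc w
      ≤w′ {i} i∈ with i ≟ᶠ q
      ... | yes refl = ≤-reflexive (taken-value ε)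
      ... | no i≢q   = ≤w (narrow i∈ i≢q)

    extends⇒taken : Extends (suc w) xs (q ∷ ys) p x → val x q ≡ suc w → x ≢ p′ → Extends (suc w) xs ys p′ x
    extends⇒taken ε eq x≢p′ = record
      { same = same′ ; ≤w = ≤w ∘ widen ; <w = <w ; other = x≢p′ ; bounded = bdd }
      where
      open Extends ε renaming (bounded to bdd)
      same′ : ∀ i → i ∈ xs ʳ++ ys ⊎ lookup x i ≡ lookup p′ i
      same′ i with same i | i ≟ᶠ q
      ... | _        | yes refl = inj₂ (toℕ-injective (trans eq (sym vq)))
      ... | inj₁ i∈  | no i≢q   = inj₁ (narrow i∈ i≢q)
      ... | inj₂ eq′ | no i≢q   = inj₂ (trans eq′ (sym (lookup-put-≢ p w<n i≢q)))

    skipped⇒extends : Extends (suc w) (q ∷ xs) ys p x → Extends (suc w) xs (q ∷ ys) p x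
    skipped⇒extends ε = record
      { same = same ; ≤w = ≤w ; <w = <w ∘ there ; other = other ; bounded = bdd }
      where open Extends ε renaming (bounded to bdd)

    extends⇒skipped : Extends (suc w) xs (q ∷ ys) p x → val x q ≢ suc w → Extends (suc w) (q ∷ xs) ys p x
    extends⇒skipped ε neq = record
      { same = same ; ≤w = ≤w ; <w = <w′ ; other = other ; bounded = bdd }
      where
      open Extends ε renaming (bounded to bdd)
      <w′ : ∀ {i} → i ∈ q ∷ xs → val x i < suc w
      <w′ (here refl) = ≤∧≢⇒< (≤w q∈) neq
      <w′ (there i∈)  = <w i∈

lower⇒extends : Extends w [] (xs ʳ++ ys) p x → Extends (suc w) xs ys p x
lower⇒extends {ys = ys} ε = record
  { same = same ; ≤w = m≤n⇒m≤1+n ∘ ≤w ; <w = s≤s ∘ ≤w ∘ ∈-ʳ++ˡ ys ; other = other ; bounded = bounded }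
  where open Extends ε

-- At the end of the list every car has been passed over for `suc w`. If `s ≤ suc w`, the `n ∸ s`
-- cars outside the list already have values from `suc w` on, and one more would exceed the
-- `n ∸ suc w` that `Bounded` permits.
extends⇒lower : ∀ {n s w xs ys} {p x : Map n} →
                State s (suc w) (xs ʳ++ ys) p → s ≤ suc w ⊎ suc w < s × ys ≡ [] →
                Extends (suc w) xs ys p x → Extends w [] (xs ʳ++ ys) p x
extends⇒lower {n = n} {s = s} {w = w} {xs = xs} {ys = ys} {p = p} {x = x} σ stuck ε = record
  { same = same ; ≤w = s≤s⁻¹ ∘ below stuck ; <w = λ () ; other = other ; bounded = Extends.bounded ε }
  where
  open State σ
  open Extends ε hiding (bounded)
  below : s ≤ suc w ⊎ suc w < s × ys ≡ [] → ∀ {i} → i ∈ xs ʳ++ ys → val x i < suc w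
  below (inj₂ (_ , refl)) i∈ = <w
    (∈-resp-↭ (↭-trans (↭-sym (++↭ʳ++ xs [])) (↭-reflexive (++-identityʳ xs))) i∈)
  below (inj₁ s≤w) {i} i∈ = ≤∧≢⇒< (≤w i∈) λ eq → <-irrefl refl (begin-strict
    n ∸ s                          ≡⟨ cong (_∸ s) count ⟨
    s + # (λ j → 1 ≤? val p j) ∸ s ≡⟨ m+n∸m≡n s _ ⟩
    # (λ j → 1 ≤? val p j)         <⟨ #-strict (λ j → 1 ≤? val p j) (λ j → suc w ≤? val x j) kept i
                                        (λ 1≤ → <⇒≱ 1≤ (≤-reflexive (ones i∈))) (≤-reflexive (sym eq)) ⟩
    # (λ j → suc w ≤? val x j)     ≤⟨ Extends.bounded ε (suc w) ⟩
    n ∸ suc w                      ≤⟨ ∸-monoʳ-≤ n s≤w ⟩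
    n ∸ s                          ∎)
    where
    open ≤-Reasoning
    kept : ∀ j → 1 ≤ val p j → suc w ≤ val x j
    kept j 1≤ with large j
    ... | inj₁ j∈ = contradiction (≤-reflexive (ones j∈)) (<⇒≱ 1≤)
    ... | inj₂ w≤ with same j
    ...   | inj₁ j∈ = contradiction (≤-reflexive (ones j∈)) (<⇒≱ 1≤)
    ...   | inj₂ eq = ≤-trans w≤ (≤-reflexive (cong toℕ (sym eq)))

mutual
  sound : ∀ b (t : Forest s w xs ys p) → x ∈ maps b t → Extends w xs ys p x
  sound b (stay t)    x∈ = sound⁺ b t x∈
  sound b (row _ _ t) x∈ = lower⇒extends (sound⁺ b t x∈)

  sound⁺ : ∀ b (t : Forest⁺ s w xs ys p) → x ∈ maps⁺ b t → Extends w xs ys p x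
  sound⁺ true (node σ w<n w≤s t u) (here refl) = put-extends σ w<n w≤s
  sound⁺ true (node σ w<n w≤s t u) (there x∈) with ∈-++⁻ (maps false t) x∈
  ... | inj₁ x∈t = taken⇒extends σ w<n w≤s (sound false t x∈t)
  ... | inj₂ x∈u = skipped⇒extends σ w<n w≤s (sound true u x∈u)
  sound⁺ false (node σ w<n w≤s t u) x∈ with ∈-++⁻ (maps true t) x∈
  ... | inj₁ x∈t         = taken⇒extends σ w<n w≤s (sound true t x∈t)
  ... | inj₂ (here refl) = put-extends σ w<n w≤s
  ... | inj₂ (there x∈u) = skipped⇒extends σ w<n w≤s (sound false u x∈u)

mutual
  complete : ∀ b (t : Forest s w xs ys p) → Extends w xs ys p x → x ∈ maps b t
  complete b (stay t)        ε = complete⁺ b t ε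
  complete b (row σ stuck t) ε = complete⁺ b t (extends⇒lower σ stuck ε)

  complete⁺ : ∀ b (t : Forest⁺ s w xs ys p) → Extends w xs ys p x → x ∈ maps⁺ b t
  complete⁺ b (stop σ) ε = contradiction (lookup-injective unchanged) other
    where
    open Extends ε
    unchanged : ∀ i → _
    unchanged i with same i
    ... | inj₂ eq = eq
    ... | inj₁ i∈ = toℕ-injective (trans (n≤0⇒n≡0 (≤w i∈)) (sym (State.ones σ i∈)))
  complete⁺ {x = x} b (node {w = w} {q = q} {p = p} σ w<n w≤s t u) ε
    with val x q ≟ suc w | ≡-dec _≟ᶠ_ x (put p q w<n)
  complete⁺ true  (node σ w<n w≤s t u) ε | no neq | _ =
    there (∈-++⁺ʳ _ (complete true u (extends⇒skipped σ w<n w≤s ε neq)))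
  complete⁺ false (node σ w<n w≤s t u) ε | no neq | _ =
    ∈-++⁺ʳ (maps true t) (there (complete false u (extends⇒skipped σ w<n w≤s ε neq)))
  complete⁺ true  (node σ w<n w≤s t u) ε | yes eq | yes refl = here refl
  complete⁺ false (node σ w<n w≤s t u) ε | yes eq | yes refl = ∈-++⁺ʳ (maps true t) (here refl)
  complete⁺ true  (node σ w<n w≤s t u) ε | yes eq | no x≢ =
    there (∈-++⁺ˡ (complete false t (extends⇒taken σ w<n w≤s ε eq x≢)))
  complete⁺ false (node σ w<n w≤s t u) ε | yes eq | no x≢ =
    ∈-++⁺ˡ (complete true t (extends⇒taken σ w<n w≤s ε eq x≢))

mutual
  maps-unique : ∀ b (t : Forest s w xs ys p) → Unique (maps b t)
  maps-unique b (stay t)    = maps⁺-unique b t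
  maps-unique b (row _ _ t) = maps⁺-unique b t

  -- The value of `q` is `suc w` throughout `t` and smaller throughout `u`; the child itself is kept
  -- out of `t` by `other`.
  maps⁺-unique : ∀ b (t : Forest⁺ s w xs ys p) → Unique (maps⁺ b t)
  maps⁺-unique b (stop _) = []
  maps⁺-unique true (node {q = q} {p = p} σ w<n w≤s t u) =
    All.tabulate fresh ∷ Unique-++⁺ (maps-unique false t) (maps-unique true u)
      λ { (x∈t , x∈u) → <⇒≢ (Extends.<w (sound true u x∈u) (here refl))
                          (taken-value σ w<n w≤s (sound false t x∈t)) }
    where
    fresh : ∀ {x} → x ∈ maps false t ++ maps true u → put p q w<n ≢ x
    fresh x∈ refl with ∈-++⁻ (maps false t) x∈
    ... | inj₁ x∈t = Extends.other (sound false t x∈t) refl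
    ... | inj₂ x∈u = <⇒≢ (Extends.<w (sound true u x∈u) (here refl)) (val-put-≡ p q w<n)
  maps⁺-unique false (node {q = q} {p = p} σ w<n w≤s t u) =
    Unique-++⁺ (maps-unique true t) (All.tabulate fresh ∷ maps-unique false u) λ
      { (x∈t , here refl)  → Extends.other (sound true t x∈t) refl
      ; (x∈t , there x∈u) → <⇒≢ (Extends.<w (sound false u x∈u) (here refl))
                                (taken-value σ w<n w≤s (sound true t x∈t)) }
    where
    fresh : ∀ {x} → x ∈ maps false u → put p q w<n ≢ x
    fresh x∈u refl = <⇒≢ (Extends.<w (sound false u x∈u) (here refl)) (val-put-≡ p q w<n)

-- Runs of the program

Array : Set
Array = ℕ → ℕ

-- The registers `one` and `z` are fixed at 1 and 0, as they are once the first instruction has been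
-- executed.
cfg : (pc n w l q top s b t : ℕ) (A nx pr pa : Array) → Config 9 3
cfg pc n w l q top s b t A nx pr pa =
  ⟪ pc , n ∷ 1 ∷ w ∷ l ∷ q ∷ top ∷ s ∷ b ∷ 0 ∷ t ∷ [] , A ∷ nx ∷ pr ∷ pa ∷ [] ⟫

module _ {B : ℕ} where

  private
    Run : Config 9 3 → ℕ → Config 9 3 → Set
    Run = Steps program B

  append : ∀ {c c′ c″ t t′} → Run c t c′ → Run c′ t′ c″ → Run c (t + t′) c″
  append done           σ = σ
  append (step f leg ρ) σ = step f leg (append ρ σ)

  delayed : ∀ {d n s c t c′} {ps : List (Map n)} → Run c t c′ →
            Generates program B d s c′ ps → Generates program B d (t + s) c ps
  delayed {t = t} ρ (halts σ t≤s f)        = halts (append ρ σ) (+-monoʳ-≤ t t≤s) f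
  delayed {t = t} ρ (outputs σ t≤s f h g)  = outputs (append ρ σ) (+-monoʳ-≤ t t≤s) f h g

  within : ∀ {d n s s′ c} {ps : List (Map n)} → s ≤ s′ →
           Generates program B d s c ps → Generates program B d s′ c ps
  within s≤ (halts σ t≤s f)       = halts σ (≤-trans t≤s s≤) f
  within s≤ (outputs σ t≤s f h g) = outputs σ (≤-trans t≤s s≤) f h g

  module _ {pc : ℕ} {R : Vec ℕ 10} {A : Vec Array 4} {t : ℕ} {c′ : Config 9 3} where

    private
      c : Config 9 3
      c = ⟪ pc , R , A ⟫

    load : ∀ {x y a v} → fetch program c ≡ just (op (x ≔ a ⟨ y ⟩)) → lookup R y ≤ B →
           lookup A a (lookup R y) ≡ v → Run ⟪ suc pc , R [ x ]≔ v , A ⟫ t c′ → Run c (suc t) c′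
    load f leg refl ρ = step f leg ρ

    -- `Dec.does` of `_<?_` computes to the test `_<ᵇ_` made by the machine, so a proof about the
    -- order decides the jump.
    branch< : ∀ {x y m β} → fetch program c ≡ just (op (if x < y goto m)) →
              Dec.does (lookup R x <? lookup R y) ≡ β →
              Run ⟪ (if β then m else suc pc) , R , A ⟫ t c′ → Run c (suc t) c′
    branch< f refl ρ = step f tt ρ

    branch≡ : ∀ {x y m β} → fetch program c ≡ just (op (if x ≡ y goto m)) →
              Dec.does (lookup R x ≟ lookup R y) ≡ β →
              Run ⟪ (if β then m else suc pc) , R , A ⟫ t c′ → Run c (suc t) c′
    branch≡ f refl ρ = step f tt ρ

  module _ {n l q s b t : ℕ} {A nx pr pa : Array} where

    run-stop : ∀ {top} → Run (cfg 11 n 1 l q top s b t A nx pr pa) 1 (cfg 29 n 1 l q top s b t A nx pr pa)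
    run-stop = step refl tt done

    run-row-full : ∀ {w top} → s < suc (suc w) →
      Run (cfg 11 n (suc (suc w)) l q top s b t A nx pr pa) 5 (cfg 11 n (suc w) 0 q top s b t A nx pr pa)
    run-row-full {w} s<w = step refl tt (branch< refl (dec-true (s <? suc (suc w)) s<w)
      (step refl tt (step refl tt (step refl tt done))))

    run-row-end : ∀ {w top} → ¬ s < suc (suc w) → l ≤ B → nx l ≡ 0 →
      Run (cfg 11 n (suc (suc w)) l q top s b t A nx pr pa) 7 (cfg 11 n (suc w) 0 0 top s b t A nx pr pa)
    run-row-end {w} s≮w l≤B end = step refl tt (branch< refl (dec-false (s <? suc (suc w)) s≮w)
      (load refl l≤B end
      (step refl tt (step refl tt (step refl tt (step refl tt done))))))

    run-take : ∀ {w top i} → ¬ suc s < suc (suc w) → l ≤ B → suc i ≤ B → nx l ≡ suc i →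
      Run (cfg 11 n (suc (suc w)) l q top (suc s) b t A nx pr pa) 11
          (cfg 22 n (suc (suc w)) l (suc i) (suc i) s b (nx (suc i))
            (write A (suc i) (suc (suc w))) (write nx l (nx (suc i)))
            (write pr (suc i) l) (write pa (suc i) top))
    run-take {w} s≮w l≤B i≤B eq = step refl tt (branch< refl (dec-false (suc s <? suc (suc w)) s≮w)
      (load refl l≤B eq
      (step refl tt
      (step refl i≤B
      (step refl i≤B
      (step refl l≤B
      (step refl i≤B
      (step refl i≤B
      (step refl tt
      (step refl tt done))))))))))

    run-leave : ∀ {w i w′ l′ top′} → suc i ≤ B → l′ ≤ B → suc s ≤ B →
      A (suc i) ≡ w′ → pr (suc i) ≡ l′ → pa (suc i) ≡ top′ →
      Run (cfg 33 n w l q (suc i) s b t A nx pr pa) 9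
          (cfg 11 n w′ (suc i) (suc i) top′ (suc s) b t (write A (suc i) 1) (write nx l′ (suc i)) pr pa)
    run-leave i≤B l≤B s≤B eq₁ eq₂ eq₃ = step refl tt
      (load refl i≤B eq₁
      (step refl i≤B
      (load refl i≤B eq₂
      (step refl l≤B
      (load refl i≤B eq₃
      (step refl s≤B
      (step refl tt
      (step refl tt done))))))))

-- Array writes and the linked list in memory

write-≡ : (f : Array) (i v : ℕ) → write f i v i ≡ v
write-≡ f i v = cong (if_then v else f i) (dec-true (i ≟ i) refl)

write-≢ : (f : Array) {i j : ℕ} (v : ℕ) → i ≢ j → write f i v j ≡ f j
write-≢ f {i} {j} v i≢j = cong (if_then v else f j) (dec-false (i ≟ j) i≢j)

cell : Fin n → ℕ
cell i = suc (toℕ i)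

cell-≢ : {i j : Fin n} → i ≢ j → cell i ≢ cell j
cell-≢ i≢j eq = i≢j (toℕ-injective (suc-injective eq))

∈-∉⇒≢ : {i j : Fin n} → i ∈ F → j ∉ F → i ≢ j
∈-∉⇒≢ i∈ j∉ refl = j∉ i∈

-- The free list is a linked list with header cell 0, which also ends it; ptr xs
-- is the cell before the cursor.
ptr : List (Fin n) → ℕ
ptr []      = 0
ptr (i ∷ _) = cell i

Chain : Array → ℕ → List (Fin n) → Set
Chain nx a []       = nx a ≡ 0
Chain nx a (i ∷ ys) = nx a ≡ cell i × Chain nx (cell i) ys

Back : Array → List (Fin n) → Set
Back nx []       = ⊤
Back nx (i ∷ xs) = nx (ptr xs) ≡ cell i × Back nx xs

Links : Array → List (Fin n) → List (Fin n) → Set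
Links nx xs ys = Back nx xs × Chain nx (ptr xs) ys

private variable
  nx nx′ nx″ : Array

rewind : (xs : List (Fin n)) → Links nx xs ys → Chain nx 0 (xs ʳ++ ys)
rewind []       (_ , ch)       = ch
rewind (i ∷ xs) ((e , bk) , ch) = rewind xs (bk , e , ch)

unwind : (xs : List (Fin n)) → Chain nx 0 (xs ʳ++ ys) → Links nx xs ys
unwind []       ch = tt , ch
unwind (i ∷ xs) ch with unwind xs ch
... | bk , e , ch′ = (e , bk) , ch′

chain-head : ∀ {a b} (ys : List (Fin n)) → Chain nx a ys → Chain nx′ b ys → nx a ≡ nx′ b
chain-head []       e       e′       = trans e (sym e′)
chain-head (i ∷ ys) (e , _) (e′ , _) = trans e (sym e′)

chain-cong : ∀ {a b} (ys : List (Fin n)) → nx′ b ≡ nx a → (∀ {i} → i ∈ ys → nx′ (cell i) ≡ nx (cell i)) →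
             Chain nx a ys → Chain nx′ b ys
chain-cong []       e f ch       = trans e ch
chain-cong (i ∷ ys) e f (h , ch) = trans e h , chain-cong ys (f (here refl)) (f ∘ there) ch

back-cong : ∀ {j} (xs : List (Fin n)) → nx′ 0 ≡ nx 0 → (∀ {i} → i ∈ xs → nx′ (cell i) ≡ nx (cell i)) →
            Back nx (j ∷ xs) → Back nx′ (j ∷ xs)
back-cong []       e f (h , _)  = trans e h , tt
back-cong (i ∷ xs) e f (h , bk) = trans (f (here refl)) h , back-cong xs e (f ∘ there) bk

pivot∉ : ∀ (xs : List (Fin n)) → Unique (xs ʳ++ (q ∷ ys)) → q ∉ xs ʳ++ ys
pivot∉ xs = Unique[x∷xs]⇒x∉xs ∘ Unique-resp-↭ (ʳ++-shift xs)

ptr-≢ : ∀ (xs : List (Fin n)) → q ∉ xs → ptr xs ≢ cell q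
ptr-≢ []       q∉ ()
ptr-≢ (i ∷ xs) q∉ eq = q∉ (here (sym (toℕ-injective (suc-injective eq))))

back-write : ∀ {v} (xs : List (Fin n)) → Unique (xs ʳ++ ys) → Back nx xs → Back (write nx (ptr xs) v) xs
back-write []       u bk = tt
back-write {ys = ys} {nx = nx} {v = v} (j ∷ xs) u bk = back-cong xs (write-≢ nx {cell j} v λ ())
  (λ i∈ → write-≢ nx v (cell-≢ (∈-∉⇒≢ i∈ j∉ ∘ sym))) bk
  where j∉ = pivot∉ xs u ∘ ∈-ʳ++ˡ ys

ptr-fresh : ∀ (xs : List (Fin n)) → Unique (xs ʳ++ ys) → ∀ {i} → i ∈ ys → ptr xs ≢ cell i
ptr-fresh (j ∷ xs) u i∈ = cell-≢ (∈-∉⇒≢ i∈ (pivot∉ xs u ∘ ∈-ʳ++ʳ xs) ∘ sym)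

tail-unique : ∀ (xs : List (Fin n)) → Unique (xs ʳ++ (q ∷ ys)) → Unique (xs ʳ++ ys)
tail-unique xs u with _ ∷ u′ ← Unique-resp-↭ (ʳ++-shift xs) u = u′

unlink : ∀ (xs : List (Fin n)) → Unique (xs ʳ++ (q ∷ ys)) → Links nx xs (q ∷ ys) →
         Links (write nx (ptr xs) (nx (cell q))) xs ys
unlink {q = q} {ys = ys} {nx = nx} xs u (bk , _ , ch) =
  back-write xs u bk ,
  chain-cong ys (write-≡ nx (ptr xs) _) (λ i∈ → write-≢ nx _ (ptr-fresh xs u (there i∈))) ch

-- What a search must leave intact: the cars outside its list keep the pointers from which they will
-- be restored. The header, cell 0, belongs to no car and may change.
record Frame (F : List (Fin n)) (f g : Array) : Set where
  constructor frame
  field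
    same : ∀ {i} → i ∉ F → g (cell i) ≡ f (cell i)

open Frame

frame-refl : ∀ {f} → Frame F f f
frame-refl = frame λ _ → refl

frame-trans : ∀ {f g h} → Frame F f g → Frame F g h → Frame F f h
frame-trans α β = frame λ i∉ → trans (same β i∉) (same α i∉)

-- After the search with q removed from the list, next ⟨ q ⟩ still is the
-- successor of q, because that search only changes cells 0 and those of the list.
relink : ∀ (xs : List (Fin n)) → Unique (xs ʳ++ (q ∷ ys)) → Links nx xs (q ∷ ys) →
         Chain nx″ 0 (xs ʳ++ ys) → nx″ (cell q) ≡ nx (cell q) →
         Links (write nx″ (ptr xs) (cell q)) (q ∷ xs) ys
relink {q = q} {ys = ys} {nx = nx} {nx″ = nx″} xs u (_ , _ , ch) ch″ eq with unwind xs ch″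
... | bk , ch‴ =
  (write-≡ nx″ (ptr xs) _ , back-write xs u′ bk) ,
  chain-cong ys
    (trans (write-≢ nx″ _ (ptr-≢ xs (pivot∉ xs u ∘ ∈-ʳ++ˡ ys))) (trans eq (chain-head ys ch ch‴)))
    (λ i∈ → write-≢ nx″ _ (ptr-fresh xs u′ i∈)) ch‴
  where u′ = tail-unique xs u

ptr-outside : ∀ (xs : List (Fin n)) ys {i} → i ∉ xs ʳ++ ys → ptr xs ≢ cell i
ptr-outside xs ys i∉ = ptr-≢ xs (i∉ ∘ ∈-ʳ++ˡ ys)

-- Both writes go to `ptr xs`, which is the header or the cell of a car in the list.
frame-list : ∀ (xs : List (Fin n)) {nx nx″ v v′} → Frame (xs ʳ++ ys) (write nx (ptr xs) v) nx″ →
             Frame (xs ʳ++ (q ∷ ys)) nx (write nx″ (ptr xs) v′)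
frame-list {ys = ys} {q = q} xs {nx} {nx″} fr = frame λ i∉ →
  let i∉′ = i∉ ∘ ∈-resp-↭ (↭-sym (ʳ++-shift xs)) ∘ there in
  trans (write-≢ nx″ _ (ptr-outside xs (q ∷ ys) i∉))
  (trans (same fr i∉′) (write-≢ nx _ (ptr-outside xs ys i∉′)))

frame-stack : ∀ (xs : List (Fin n)) {v} {f g : Array} → Frame (xs ʳ++ ys) (write f (cell q) v) g →
              Frame (xs ʳ++ (q ∷ ys)) f g
frame-stack {q = q} xs {f = f} fr = frame λ i∉ →
  trans (same fr (i∉ ∘ ∈-resp-↭ (↭-sym (ʳ++-shift xs)) ∘ there))
        (write-≢ f _ (cell-≢ (∈-∉⇒≢ (∈-ʳ++ʳ xs (here refl)) i∉)))

record Values (A : Array) (p : Map n) : Set where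
  constructor values
  field
    value : ∀ i → A (cell i) ≡ suc (val p i)

open Values

values-put : ∀ A (p : Map n) q (w<n : w < n) → Values A p → Values (write A (cell q) (suc w)) (put p q w<n)
values-put {n = n} {w = w} A p q w<n h = values at
  where
  at : ∀ i → write A (cell q) (suc w) (cell i) ≡ suc (val (put p q w<n) i)
  at i with i ≟ᶠ q
  ... | yes refl = trans (write-≡ A (cell q) _) (cong suc (sym (val-put-≡ p q w<n)))
  ... | no i≢q   = trans (write-≢ A _ (cell-≢ (i≢q ∘ sym)))
                         (trans (value h i) (cong suc (sym (val-put-≢ p w<n i≢q))))

values-unput : ∀ A (p : Map n) q (w<n : w < n) → val p q ≡ 0 →
               Values A (put p q w<n) → Values (write A (cell q) 1) p
values-unput A p q w<n q≡0 h = values at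
  where
  at : ∀ i → write A (cell q) 1 (cell i) ≡ suc (val p i)
  at i with i ≟ᶠ q
  ... | yes refl = trans (write-≡ A (cell q) _) (cong suc (sym q≡0))
  ... | no i≢q   = trans (write-≢ A _ (cell-≢ (i≢q ∘ sym)))
                         (trans (value h i) (cong suc (val-put-≢ p w<n i≢q)))

-- The delay between consecutive outputs

bit : Bool → ℕ
bit false = 0
bit true  = 1

-- A true forest lists a node before the nodes below it, a false one after them,
-- so a bounded number of moves without output lead to the first map of a
-- forest (entry) and from its last map to its end (49 − exit).
entry exit : Bool → ℕ
entry true  = 12
entry false = 33
exit  true  = 3
exit  false = 31

module _ {n B : ℕ} (n≤B : n ≤ B) where

  private
    Gen : ℕ → Config 9 3 → List (Map n) → Set
    Gen = Generates program B 49

    cell≤B : ∀ (i : Fin n) → cell i ≤ B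
    cell≤B i = ≤-trans (toℕ<n i) n≤B

    ptr≤B : ∀ (xs : List (Fin n)) → ptr xs ≤ B
    ptr≤B []      = z≤n
    ptr≤B (i ∷ _) = cell≤B i

  -- A run is linear while the tree is nested, so the search is verified in continuation form: once
  -- it arrives at 29 with values and list restored and the other cars' pointers intact, whatever
  -- the scratch registers hold, the remaining maps `ps` follow.
  Continues : Bool → ℕ → ℕ → List (Fin n) → Map n → (nx pr pa : Array) → List (Map n) → Set
  Continues b top s F p nx pr pa ps = ∀ {w l q t A′ nx′ pr′ pa′} →
    Values A′ p → Chain nx′ 0 F → Frame F nx nx′ → Frame F pr pr′ → Frame F pa pa′ →
    Gen (exit b) (cfg 29 n w l q top s (bit b) t A′ nx′ pr′ pa′) ps

  mutual
    -- The 7 pays for the longer of the two kinds of `row`; at most one of them precedes a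
    -- `Forest⁺`.
    generates : ∀ {s w xs ys p top q t A nx pr pa ps} b (f : Forest s w xs ys p) →
                Values A p → Links nx xs ys → Continues b top s (xs ʳ++ ys) p nx pr pa ps →
                Gen (7 + entry b) (cfg 11 n (suc w) (ptr xs) q top s (bit b) t A nx pr pa) (maps b f ++ ps)
    generates b (stay f) h ln k = within (m≤n+m (entry b) 7) (generates⁺ b f h ln k)
    generates {xs = xs} b (row σ (inj₁ s≤w) f) h ln k =
      within (+-monoˡ-≤ (entry b) (≤ᵇ⇒≤ 5 7 tt))
        (delayed (run-row-full (s≤s s≤w)) (generates⁺ b f h (tt , rewind xs ln) k))
    generates {xs = xs} b (row σ (inj₂ (w<s , refl)) f) h ln k =
      delayed (run-row-end (≤⇒≯ w<s) (ptr≤B xs) (proj₂ ln))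
        (generates⁺ b f h (tt , rewind xs ln) k)

    generates⁺ : ∀ {s w xs ys p top q t A nx pr pa ps} b (f : Forest⁺ s w xs ys p) →
                 Values A p → Links nx xs ys → Continues b top s (xs ʳ++ ys) p nx pr pa ps →
                 Gen (entry b) (cfg 11 n (suc w) (ptr xs) q top s (bit b) t A nx pr pa) (maps⁺ b f ++ ps)
    generates⁺ {xs = xs} true (stop _) h ln k =
      within (≤ᵇ⇒≤ 4 12 tt) (delayed run-stop (k h (rewind xs ln) frame-refl frame-refl frame-refl))
    generates⁺ {xs = xs} false (stop _) h ln k =
      within (≤ᵇ⇒≤ 32 33 tt) (delayed run-stop (k h (rewind xs ln) frame-refl frame-refl frame-refl))
    generates⁺ {ps = ps} true (node {xs = xs} {q = i} {p = p} σ w<n w≤s f g) h ln k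
      rewrite ++-assoc (maps false f) (maps true g) ps =
      -- Eleven moves and the parity test come before this output: the 12 of `entry true`.
      delayed (run-take (≤⇒≯ (s≤s w≤s)) (ptr≤B xs) (cell≤B i) (proj₁ (proj₂ ln)))
        (outputs (step refl tt done) (s≤s z≤n) refl (value (values-put _ p i w<n h))
          (within (≤ᵇ⇒≤ 42 49 tt) (delayed (step refl tt (step refl tt done))
            (generates false f (values-put _ p i w<n h) (unlink xs (State.unique σ) ln)
              -- Three moves lead up from the child, then 9 restore the car and `7 + entry true`
              -- reach the next output: the 31 of `exit false`.
              λ h′ ch fn fr fa → delayed (step refl tt (step refl tt (step refl tt done)))
                (returns true σ w<n g ln k h′ ch fn fr fa)))))
    generates⁺ {ps = ps} false (node {xs = xs} {q = i} {p = p} σ w<n w≤s f g) h ln k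
      rewrite ++-assoc (maps true f) (put p i w<n ∷ maps false g) ps =
      delayed (run-take (≤⇒≯ (s≤s w≤s)) (ptr≤B xs) (cell≤B i) (proj₁ (proj₂ ln)))
        -- With the eleven moves above and `7 + entry true` below, these three make the 33 of
        -- `entry false`.
        (delayed (step refl tt (step refl tt (step refl tt done)))
          (generates true f (values-put _ p i w<n h) (unlink xs (State.unique σ) ln)
            λ h′ ch fn fr fa →
              -- The worst case follows this output: 9 moves to restore the car and
              -- `7 + entry false` to the next output, 49 in all.
              outputs (step refl tt (step refl tt (step refl tt done))) ≤-refl refl (value h′)
              (returns false σ w<n g ln k h′ ch fn fr fa)))

    -- The pointers of `i` were written when it was removed, and the frames show that the search
    -- below has not changed them. So `i` can be put back, and its later siblings are searched.
    returns : ∀ {s w xs i ys p top w′ l q t A nx pr pa nx′ pr′ pa′ ps} b →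
              State (suc s) (suc w) (xs ʳ++ (i ∷ ys)) p → (w<n : suc w < n) →
              (g : Forest (suc s) (suc w) (i ∷ xs) ys p) →
              Links nx xs (i ∷ ys) → Continues b top (suc s) (xs ʳ++ (i ∷ ys)) p nx pr pa ps →
              Values A (put p i w<n) → Chain nx′ 0 (xs ʳ++ ys) →
              Frame (xs ʳ++ ys) (write nx (ptr xs) (nx (cell i))) nx′ →
              Frame (xs ʳ++ ys) (write pr (cell i) (ptr xs)) pr′ →
              Frame (xs ʳ++ ys) (write pa (cell i) top) pa′ →
              Gen (16 + entry b) (cfg 33 n w′ l q (cell i) s (bit b) t A nx′ pr′ pa′) (maps b g ++ ps)
    returns {s} {xs = xs} {i = i} {ys = ys} {p = p} {nx = nx} {pr = pr} {pa = pa}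
            b σ w<n g ln k h ch fn fr fa =
      delayed
        (run-leave (cell≤B i) (ptr≤B xs) (≤-trans (m+n≤o⇒m≤o (suc s) (≤-reflexive count)) n≤B)
          (trans (value h i) (cong suc (val-put-≡ p i w<n)))
          (trans (same fr i∉) (write-≡ pr (cell i) _)) (trans (same fa i∉) (write-≡ pa (cell i) _)))
        (generates b g (values-unput _ p i w<n (ones (∈-ʳ++ʳ xs (here refl))) h)
          (relink xs unique ln ch (trans (same fn i∉) (write-≢ nx _ (ptr-outside xs ys i∉))))
          λ h′ ch′ fn′ fr′ fa′ → k h′ ch′
            (frame-trans (frame-list xs fn) fn′)
            (frame-trans (frame-stack xs fr) fr′)
            (frame-trans (frame-stack xs fa) fa′))
      where
      open State σ
      i∉ = pivot∉ xs unique

  -- Initialization in linear time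

  -- The loop invariant after `k` rounds with `m` to come, at six operations per round and one last
  -- test. The cells not yet written are still 0, so the list ends by itself at cell `n`.
  run-init : ∀ {A nx pr pa} m k {l} → k + m ≡ n →
    (∀ j → j < k → A (suc j) ≡ 1) → (∀ j → j < k → nx j ≡ suc j) → (∀ j → k ≤ j → nx j ≡ 0) →
    ∃[ l′ ] ∃[ A′ ] ∃[ nx′ ] (∀ j → j < n → A′ (suc j) ≡ 1) × (∀ j → j < n → nx′ j ≡ suc j) × nx′ n ≡ 0 ×
    Steps program B (cfg 1 n 0 l k 0 0 0 0 A nx pr pa) (m * 6 + 1) (cfg 7 n 0 l′ n 0 0 0 0 A′ nx′ pr pa)
  run-init zero k refl hA hn hz rewrite +-identityʳ k =
    _ , _ , _ , hA , hn , hz k ≤-refl , branch≡ refl (dec-true (k ≟ k) refl) done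
  run-init {A} {nx} {pr} {pa} (suc m) k eq hA hn hz
    with k<n ← subst (k <_) eq (m<m+n k (s≤s z≤n))
    with run-init {write A (suc k) 1} {write nx k (suc k)} {pr} {pa} m (suc k) (trans (sym (+-suc k m)) eq)
         (λ j j≤k → extendA j j≤k) extendN
         (λ j k<j → trans (write-≢ nx _ (<⇒≢ k<j)) (hz j (<⇒≤ k<j)))
    where
    extendA : ∀ j → j < suc k → write A (suc k) 1 (suc j) ≡ 1
    extendA j j≤k with j ≟ k
    ... | yes refl = write-≡ A (suc k) 1
    ... | no j≢k   = trans (write-≢ A 1 (j≢k ∘ sym ∘ suc-injective)) (hA j (≤∧≢⇒< (s≤s⁻¹ j≤k) j≢k))
    extendN : ∀ j → j < suc k → write nx k (suc k) j ≡ suc j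
    extendN j j≤k with j ≟ k
    ... | yes refl = write-≡ nx k _
    ... | no j≢k   = trans (write-≢ nx _ (j≢k ∘ sym)) (hn j (≤∧≢⇒< (s≤s⁻¹ j≤k) j≢k))
  ... | l′ , A′ , nx′ , hA′ , hn′ , hz′ , ρ = l′ , A′ , nx′ , hA′ , hn′ , hz′ ,
    branch≡ refl (dec-false (k ≟ n) (<⇒≢ k<n))
    (step refl tt
    (step refl (≤-trans (≤-reflexive (+-comm k 1)) (≤-trans k<n n≤B))
    -- The machine computes `k + 1`, whereas the invariant speaks of `suc k`.
    (subst (λ k′ → Steps program B (cfg 4 n 0 k k′ 0 0 0 0 A nx pr pa) (3 + (m * 6 + 1))
                     (cfg 7 n 0 l′ n 0 0 0 0 A′ nx′ pr pa)) (+-comm 1 k)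
    (step refl (≤-trans (<⇒≤ k<n) n≤B)
    (step refl (≤-trans k<n n≤B)
    (step refl tt ρ))))))

chain-tabulate : ∀ {m} k (f : Fin m → Fin n) → (∀ i → toℕ (f i) ≡ k + toℕ i) →
                 (∀ j → j < k + m → nx j ≡ suc j) → nx (k + m) ≡ 0 → Chain nx k (tabulate f)
chain-tabulate {nx = nx} {m = zero} k f hf hn hz = trans (cong nx (sym (+-identityʳ k))) hz
chain-tabulate {nx = nx} {m = suc m} k f hf hn hz =
  trans (hn k (m<m+n k (s≤s z≤n))) (cong suc (sym f0)) ,
  subst (λ a → Chain nx a (tabulate (f ∘ suc))) (cong suc (sym f0))
    (chain-tabulate (suc k) (f ∘ suc) (λ i → trans (hf (suc i)) (+-suc k (toℕ i)))
      (λ j j< → hn j (subst (j <_) (sym (+-suc k m)) j<)) (trans (cong nx (sym (+-suc k m))) hz))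
  where f0 = trans (hf zero) (+-identityʳ k)

-- The whole search, from the root (1, ..., 1)

module _ (m : ℕ) where

  ones : Map (suc m)
  ones = replicate (suc m) zero

  val-ones : ∀ i → val ones i ≡ 0
  val-ones i = cong toℕ (lookup-replicate i zero)

  ones-bounded : Bounded ones
  ones-bounded zero    = #≤n (λ i → 0 ≤? val ones i)
  ones-bounded (suc u) = ≤-trans (≤-reflexive (#-empty (λ i → suc u ≤? val ones i)
    (λ i u≤ → <⇒≱ u≤ (≤-trans (≤-reflexive (val-ones i)) z≤n)))) z≤n

  initial : State (suc m) m (allFin (suc m)) ones
  initial = record
    { ones = λ {i} _ → val-ones i ; large = λ i → inj₁ (∈-allFin i) ; unique = allFin⁺ (suc m)
    ; size = length-tabulate id
    ; count = trans (cong (suc m +_) (#-empty (λ i → 1 ≤? val ones i)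
                      λ i 1≤ → <⇒≱ 1≤ (≤-reflexive (val-ones i))))
                    (+-identityʳ (suc m))
    ; bounded = ones-bounded }

  search-tree : Forest (suc m) m [] (allFin (suc m)) ones
  search-tree = forest m (allFin (suc m)) initial ≤-refl (n≤1+n m)

  bounded⇒extends : ∀ {x} → Bounded x → x ≢ ones → Extends m [] (allFin (suc m)) ones x
  bounded⇒extends bd x≢ = record
    { same = λ i → inj₁ (∈-allFin i) ; ≤w = λ {i} _ → s≤s⁻¹ (toℕ<n _) ; <w = λ ()
    ; other = x≢ ; bounded = bd }

  parking-functions : List (Map (suc m))
  parking-functions = ones ∷ maps false search-tree

  ∈⇔parking : ∀ x → x ∈ parking-functions ⇔ ParkingFunction x
  ∈⇔parking x = mk⇔
    (λ { (here refl) → bounded⇒parking ones ones-bounded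
       ; (there x∈)  → bounded⇒parking x (Extends.bounded (sound false search-tree x∈)) })
    listed
    where
    listed : ParkingFunction x → x ∈ parking-functions
    listed pf with ≡-dec _≟ᶠ_ x ones
    ... | yes eq = here eq
    ... | no x≢  = there (complete false search-tree (bounded⇒extends (parking⇒bounded x pf) x≢))

  parking-functions-unique : Unique parking-functions
  parking-functions-unique =
    All.tabulate (λ x∈ eq → Extends.other (sound false search-tree x∈) (sym eq))
    ∷ maps-unique false search-tree

  generates-all : Generates program (1 * suc m) 49 (11 * suc m) (start program (suc m)) parking-functions
  generates-all
    with run-init {suc m} {1 * suc m} (m≤m+n _ 0) {λ _ → 0} {λ _ → 0} {λ _ → 0} {λ _ → 0}
           (suc m) 0 {0} refl (λ _ ()) (λ _ ()) (λ _ _ → refl)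
  ... | l′ , A′ , nx′ , hA , hn , hz , ρ = outputs
    (step refl (s≤s z≤n) (append ρ (step refl tt (step refl tt (step refl tt done)))))
    -- One operation before the loop, `6 * n + 1` in it and three after it, where `n` is `suc m`;
    -- the constant 5 is absorbed because `n` is positive.
    (begin
      1 + (suc m * 6 + 1 + 3) ≡⟨ cong suc (trans (+-assoc (suc m * 6) 1 3) (+-comm (suc m * 6) 4)) ⟩
      5 + suc m * 6           ≤⟨ +-monoˡ-≤ (suc m * 6) (m≤n*m 5 (suc m)) ⟩
      suc m * 5 + suc m * 6   ≡⟨ *-distribˡ-+ (suc m) 5 6 ⟨
      suc m * 11              ≡⟨ *-comm (suc m) 11 ⟩
      11 * suc m              ∎)
    refl (value ones-held)
    (within (≤ᵇ⇒≤ 40 49 tt) (subst (Generates _ _ _ _ _) (++-identityʳ _)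
      (generates (m≤m+n (suc m) 0) false search-tree ones-held (tt , chain-tabulate 0 id (λ _ → refl) hn hz)
        -- At the root `top` is 0, so the test at 29 jumps to `halt`.
        λ _ _ _ _ _ → halts (step refl tt done) (s≤s z≤n) refl)))
    where
    open ≤-Reasoning
    ones-held : Values A′ ones
    ones-held = values λ i → trans (hA (toℕ i) (toℕ<n i)) (cong suc (sym (val-ones i)))

mainTheorem2 : Σ[ P ∈ Program ] ∃[ init ] ∃[ delay ] ∃[ size ]
    ((n : ℕ) → 1 ≤ n →
    Σ[ L ∈ List (Map n) ]
    (∀ (p : Map n) → p ∈ L ⇔ ParkingFunction p)
    × Unique L
    × n ≤ size * n
    × Generates P (size * n) delay (init * n) (start P n) L)
mainTheorem2 = program , 11 , 49 , 1 , λ where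
  (suc m) _ → parking-functions m , ∈⇔parking m , parking-functions-unique m ,
              m≤m+n (suc m) 0 , generates-all m
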